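{- For every message $M$ and formulas $\phi,\psi$: $\vdash\mathsf{k}_{\mathsf{CM}}(M)\to\big([M](\phi\vee\psi)\to([M]\phi\vee[M]\psi)\big)$.
   Context: Fix a finite set $\mathcal{A}$ of agent names containing a distinguished name $\mathsf{CM}$. Messages: $M ::= a \mid B \mid (M,M)$ ($a\in\mathcal{A}$, $B$ optional data constants, pairs). $\mathcal{P}$ is a denumerable set of propositional variables containing atoms $\mathsf{k}_a(M)$ ("$a$ knows $M$"). Formulas: $\phi ::= P \mid \phi\wedge\phi \mid \phi\vee\phi \mid \neg\phi \mid \phi\to\phi \mid [M]\phi$. Abbreviations: $\mathrm{true}:=\mathsf{k}_{\mathsf{CM}}(\mathsf{CM})$, $\mathrm{false}:=\neg\mathrm{true}$, $\phi\leftrightarrow\psi:=(\phi\to\psi)\wedge(\psi\to\phi)$, $\langle M\rangle\phi:=\neg\neg(\mathsf{k}_{\mathsf{CM}}(M)\wedge\phi)$. LIiP is the smallest set of formulas containing all instances of: the axioms of an adequate Hilbert axiomatization of intuitionistic propositional logic; $\mathsf{k}_a(a)$; $(\mathsf{k}_a(M)\wedge\mathsf{k}_a(M'))\leftrightarrow\mathsf{k}_a((M,M'))$; $[M]\mathsf{k}_{\mathsf{CM}}(M)$; $[M](\phi\to\psi)\to([M]\phi\to[M]\psi)$; $[M]\phi\to(\mathsf{k}_{\mathsf{CM}}(M)\to\phi)$; $[M]\phi\to\langle M\rangle\phi$; $\phi\to[M]\phi$; and closed under modus ponens and the rule: if $\mathsf{k}_{\mathsf{CM}}(M)\to\mathsf{k}_{\mathsf{CM}}(M')$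 is in the set then so is $[M']\phi\to[M]\phi$ for every $\phi$. Write $\vdash\phi$ for $\phi\in\mathrm{LIiP}$. -}

module Defs where

open import Data.Fin using (Fin)
open import Data.Nat using (ℕ)
open import Data.Product using (∃; _×_; _,_)
open import Function.Bundles using (_↔_; _↣_; Injection)

data Message (Agent Data : Set) : Set where
  agent : Agent → Message Agent Data
  datum : Data → Message Agent Data
  ⟪_,_⟫ : Message Agent Data → Message Agent Data → Message Agent Data

record Language : Set₁ where
  field
    Agent        : Set
    agent-finite : ∃ λ n → Agent ↔ Fin n
    CM           : Agent
    -- May be empty: data constants are optional.
    Data         : Set
    -- The propositional variables; the embedding `knows` makes the atoms
    -- k a M pairwise distinct elements of Var, which may have further elements.
    Var             : Set
    var-denumerable : Var ↔ ℕ
    knows           : (Agent × Message Agent Data) ↣ Var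

module LIiP (L : Language) where
  open Language L public

  Msg : Set
  Msg = Message Agent Data

  infix  30 ~_ [_]_ ⟨_⟩_
  infixr 25 _∧_
  infixr 24 _∨_
  infixr 23 _⊃_
  infix  22 _⊂⊃_
  infix  10 ⊢_

  data Formula : Set where
    var  : Var → Formula
    _∧_  : Formula → Formula → Formula
    _∨_  : Formula → Formula → Formula
    ~_   : Formula → Formula
    _⊃_  : Formula → Formula → Formula
    [_]_ : Msg → Formula → Formula

  k : Agent → Msg → Formula
  k a M = var (Injection.to knows (a , M))

  true : Formula
  true = k CM (agent CM)

  false : Formula
  false = ~ true

  _⊂⊃_ : Formula → Formula → Formula
  φ ⊂⊃ ψ = (φ ⊃ ψ) ∧ (ψ ⊃ φ)

  ⟨_⟩_ : Msg → Formula → Formula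
  ⟨ M ⟩ φ = ~ (~ (k CM M ∧ φ))

  data ⊢_ : Formula → Set where
    -- Intuitionistic propositional logic with primitive negation, after
    -- Kleene: ⊃-K to ~-E.
    ⊃-K  : ∀ φ ψ → ⊢ φ ⊃ (ψ ⊃ φ)
    ⊃-S  : ∀ φ ψ χ → ⊢ (φ ⊃ (ψ ⊃ χ)) ⊃ ((φ ⊃ ψ) ⊃ (φ ⊃ χ))
    ∧-I  : ∀ φ ψ → ⊢ φ ⊃ (ψ ⊃ (φ ∧ ψ))
    ∧-E₁ : ∀ φ ψ → ⊢ (φ ∧ ψ) ⊃ φ
    ∧-E₂ : ∀ φ ψ → ⊢ (φ ∧ ψ) ⊃ ψ
    ∨-I₁ : ∀ φ ψ → ⊢ φ ⊃ (φ ∨ ψ)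
    ∨-I₂ : ∀ φ ψ → ⊢ ψ ⊃ (φ ∨ ψ)
    ∨-E  : ∀ φ ψ χ → ⊢ (φ ⊃ χ) ⊃ ((ψ ⊃ χ) ⊃ ((φ ∨ ψ) ⊃ χ))
    ~-I  : ∀ φ ψ → ⊢ (φ ⊃ ψ) ⊃ ((φ ⊃ (~ ψ)) ⊃ (~ φ))
    ~-E  : ∀ φ ψ → ⊢ (~ φ) ⊃ (φ ⊃ ψ)

    own-name : ∀ a → ⊢ k a (agent a)
    pairing  : ∀ a M M′ → ⊢ (k a M ∧ k a M′) ⊂⊃ k a ⟪ M , M′ ⟫

    [-]-knows : ∀ M → ⊢ [ M ] (k CM M)
    [-]-K     : ∀ M φ ψ → ⊢ ([ M ] (φ ⊃ ψ)) ⊃ (([ M ] φ) ⊃ ([ M ] ψ))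
    [-]-truth : ∀ M φ → ⊢ ([ M ] φ) ⊃ (k CM M ⊃ φ)
    [-]-⟨-⟩   : ∀ M φ → ⊢ ([ M ] φ) ⊃ (⟨ M ⟩ φ)
    [-]-intro : ∀ M φ → ⊢ φ ⊃ ([ M ] φ)

    modus-ponens : ∀ {φ ψ} → ⊢ φ ⊃ ψ → ⊢ φ → ⊢ ψ
    antitonicity : ∀ {M M′} → ⊢ k CM M ⊃ k CM M′ →
                   ∀ φ → ⊢ ([ M′ ] φ) ⊃ ([ M ] φ)

{-# OPTIONS --safe #-}

-- Knowing M, truth reduces [M](φ ∨ ψ) to φ ∨ ψ, and each disjunct φ yields
-- [M]φ because φ ⊃ [M]φ is an axiom.
module Submission where

open import Defs

-- Given `k CM M`, the modality collapses: `[-]-truth` and `[-]-intro` make `[ M ] χ` equivalent to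
-- `χ`, so it commutes with `∨`. Only removing the modality uses the knowledge hypothesis;
-- `∨-[-]-intro` reinstates it on each disjunct.

module Derived (L : Language) where
  open LIiP L

  ⊃-weaken : ∀ {φ} ψ → ⊢ φ → ⊢ ψ ⊃ φ
  ⊃-weaken {φ} ψ d = modus-ponens (⊃-K φ ψ) d

  ⊃-apply : ∀ {φ ψ χ} → ⊢ φ ⊃ (ψ ⊃ χ) → ⊢ (φ ⊃ ψ) ⊃ (φ ⊃ χ)
  ⊃-apply {φ} {ψ} {χ} d = modus-ponens (⊃-S φ ψ χ) d

  ⊃-monoʳ : ∀ {φ ψ χ} → ⊢ ψ ⊃ χ → ⊢ (φ ⊃ ψ) ⊃ (φ ⊃ χ)
  ⊃-monoʳ {φ} d = ⊃-apply (⊃-weaken φ d)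

  ⊃-trans : ∀ {φ ψ χ} → ⊢ φ ⊃ ψ → ⊢ ψ ⊃ χ → ⊢ φ ⊃ χ
  ⊃-trans d e = modus-ponens (⊃-monoʳ e) d

  ⊃-swap : ∀ {φ ψ χ} → ⊢ φ ⊃ (ψ ⊃ χ) → ⊢ ψ ⊃ (φ ⊃ χ)
  ⊃-swap {φ} {ψ} d = ⊃-trans (⊃-K ψ φ) (⊃-apply d)

  ∨-elim : ∀ {φ ψ χ} → ⊢ φ ⊃ χ → ⊢ ψ ⊃ χ → ⊢ (φ ∨ ψ) ⊃ χ
  ∨-elim {φ} {ψ} {χ} d e = modus-ponens (modus-ponens (∨-E φ ψ χ) d) e

  ∨-[-]-intro : ∀ M φ ψ → ⊢ (φ ∨ ψ) ⊃ (([ M ] φ) ∨ ([ M ] ψ))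
  ∨-[-]-intro M φ ψ =
    ∨-elim (⊃-trans ([-]-intro M φ) (∨-I₁ ([ M ] φ) ([ M ] ψ)))
           (⊃-trans ([-]-intro M ψ) (∨-I₂ ([ M ] φ) ([ M ] ψ)))

theorem2p40 : (L : Language) → let open LIiP L in
    ∀ (M : Msg) (φ ψ : Formula) →
    ⊢ k CM M ⊃ (([ M ] (φ ∨ ψ)) ⊃ (([ M ] φ) ∨ ([ M ] ψ)))
theorem2p40 L M φ ψ =
  -- `[-]-truth` takes `k CM M` as its second antecedent, so the disjunction is rewritten beneath it
  -- and the antecedents are exchanged last.
  ⊃-swap (⊃-trans ([-]-truth M (φ ∨ ψ)) (⊃-monoʳ (∨-[-]-intro M φ ψ)))
  where
  open LIiP L
  open Derived L
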